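{- There is an absolute constant $C$ such that for every integer $d \ge 1$, every finite alphabet $\Sigma$, every string $T$ over $\Sigma$ of length $n > d$ and every $i$ with $1 \le i \le n-d$, $$|\mathsf{MAW}(T[i..i+d-1]) \bigtriangleup \mathsf{MAW}(T[i+1..i+d])| \le C\, d$$ (that is, this quantity is in $O(d)$). Also, there is an absolute constant $c > 0$ such that for every $d \ge 1$ there exist a string $T'$ (over some finite alphabet) with $|T'| \ge d+1$ and a position $j$ with $1 \le j \le |T'|-d$ such that $$|\mathsf{MAW}(T'[j..j+d-1]) \bigtriangleup \mathsf{MAW}(T'[j+1..j+d])| \ge c\, d$$ (that is, this quantity is in $\Omega(d)$).
   Context: Strings are finite sequences over a finite alphabet $\Sigma$; positions are 1-indexed and $T[i..j]$ denotes the substring of $T$ from position $i$ to position $j$. A string $w$ occurs in $S$ if it is a (contiguous) substring of $S$; the empty string occurs in every string. A non-empty string $w \in \Sigma^*$ is a minimal absent word (MAW) for $S$ if $w$ does not occur in $S$ but every proper substring of $w$ occurs in $S$ (in particular a single character of $\Sigma$ not occurring in $S$ is a MAW for $S$). $\mathsf{MAW}(S)$ is the set of all MAWs for $S$ relative to the alphabet $\Sigma$ of the whole string. $\bigtriangleup$ denotes symmetric difference. -}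

module Defs where

open import Data.Integer using (+_)
open import Data.List using (List; []; length; take; drop)
open import Data.List.Membership.Propositional using (_∈_)
open import Data.List.Relation.Binary.Infix.Heterogeneous using (Infix)
open import Data.List.Relation.Unary.Unique.Propositional using (Unique)
open import Data.Nat using (ℕ; suc; _∸_)
open import Data.Product using (Σ-syntax; _×_)
open import Data.Rational using (ℚ; _/_)
open import Function.Bundles using (_⇔_)
open import Level using (0ℓ)
open import Relation.Binary.PropositionalEquality using (_≡_; _≢_)
open import Relation.Nullary using (¬_)
open import Relation.Unary using (Pred; _∖_; _∪_)

private
  variable
    A : Set

infix 4 _occursIn_

_occursIn_ : List A → List A → Set
_occursIn_ = Infix _≡_

ProperSubstring : List A → List A → Set
ProperSubstring u w = u occursIn w × u ≢ w

MAW : List A → Pred (List A) 0ℓ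
MAW S w =
  w ≢ [] × ¬ (w occursIn S) × (∀ u → ProperSubstring u w → u occursIn S)

-- Positions are 1-indexed and both endpoints are included.
_[_⋯_] : List A → ℕ → ℕ → List A
T [ i ⋯ j ] = take (suc j ∸ i) (drop (i ∸ 1) T)

infixr 6 _△_

_△_ : Pred A 0ℓ → Pred A 0ℓ → Pred A 0ℓ
P △ Q = (P ∖ Q) ∪ (Q ∖ P)

-- P is finite with exactly k elements: some duplicate-free list of length k
-- lists precisely the elements satisfying P.
HasCardinality : Pred A 0ℓ → ℕ → Set
HasCardinality {A} P k =
  Σ[ xs ∈ List A ] Unique xs × length xs ≡ k × (∀ x → x ∈ xs ⇔ P x)

fromℕ : ℕ → ℚ
fromℕ n = + n / 1

{-# OPTIONS --safe #-}

-- Both windows are one-letter extensions of a common string X, so it suffices to bound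
-- |MAW(aX) △ MAW(X)|; appending a letter is the mirror image of prepending one. Let v be
-- the shortest prefix of aX that does not occur in X. A word in MAW(X) ∖ MAW(aX) occurs
-- in aX only as a prefix, hence is v. A word αuβ in MAW(aX) ∖ MAW(X) is of one of two
-- kinds. If uβ does not occur in X, then uβ = v, and α is a letter of aX. Otherwise αu
-- does not occur in X, so αu is a prefix of aX; then α = a, the word u is a prefix of X,
-- and uβ is a prefix of some suffix t of aX but not of X, so it is the shortest prefix of
-- t that is not a prefix of X, and is determined by t. No count involves the alphabet.
--
-- For the lower bound take d + 1 distinct letters x₀ x₁ … x_d: the d words x x₀ with x in
-- the first window are absent there minimally, whereas x₀ itself is absent from the second.
module Submission where

open import Defs
open import Data.Fin using (Fin; zero; suc)
open import Data.Fin.Properties using (injective⇒≤) renaming (_≟_ to _≟F_)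
import Data.Integer as ℤ
import Data.Integer.Properties as ℤ
open import Data.List
  using (List; []; _∷_; [_]; _++_; _∷ʳ_; length; map; filter; take; drop; tails; reverse;
         deduplicate; lookup; allFin; tabulate; initLast; _∷ʳ′_)
open import Data.List.Membership.Propositional using (_∈_; _∉_)
open import Data.List.Membership.Propositional.Properties
  using (∈-map⁺; ∈-map⁻; ∈-++⁺ˡ; ∈-++⁺ʳ; ∈-filter⁺; ∈-filter⁻; ∈-deduplicate⁺;
         ∈-deduplicate⁻; ∈-lookup)
open import Data.List.Properties
  using (length-map; length-++; length-filter; length-deduplicate; length-reverse;
         length-take; length-tabulate; reverse-++; reverse-involutive; reverse-injective;
         unfold-reverse; ≡-dec; ∷-injectiveˡ; ∷-injectiveʳ)
open import Data.List.Relation.Binary.Infix.Heterogeneous using (here; there; _ⁱ++_)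
open import Data.List.Relation.Binary.Infix.Heterogeneous.Properties as Infix
  using (infix?; fromSuffix; Prefix-Infix-trans)
import Data.List.Relation.Binary.Pointwise as Pointwise
open import Data.List.Relation.Binary.Prefix.Heterogeneous using (Prefix; []; _∷_; _++ᵖ_)
import Data.List.Relation.Binary.Prefix.Heterogeneous.Properties as Prefix
open import Data.List.Relation.Binary.Suffix.Heterogeneous.Properties using (fromPrefix)
import Data.List.Relation.Unary.All as All
open import Data.List.Relation.Unary.Any using (here; there; index)
open import Data.List.Relation.Unary.Any.Properties using (lookup-index)
open import Data.List.Relation.Unary.AllPairs using (_∷_)
open import Data.List.Relation.Unary.Unique.Propositional using (Unique)
open import Data.List.Relation.Unary.Unique.Propositional.Properties as Unique
  using (Unique[x∷xs]⇒x∉xs)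
open import Data.List.Relation.Unary.Unique.DecPropositional.Properties using (deduplicate-!)
open import Data.Nat as ℕ using (ℕ; zero; suc; _+_; _*_; _∸_; _≤_; _<_; z≤n; s≤s)
open import Data.Nat.Properties as ℕ using (≤-trans; ≤-reflexive)
open import Data.Product using (Σ-syntax; ∃-syntax; ∃₂; _×_; _,_; proj₁; proj₂)
open import Data.Rational as ℚ using (ℚ; 0ℚ)
import Data.Rational.Properties as ℚ
import Data.Rational.Unnormalised as ℚᵘ
import Data.Rational.Unnormalised.Properties as ℚᵘ
open import Data.Sum using (_⊎_; inj₁; inj₂; swap)
open import Function using (_∘_; id)
open import Function.Bundles using (_⇔_; mk⇔; Equivalence)
open import Level using (0ℓ)
open import Relation.Binary.Definitions using (DecidableEquality)
open import Relation.Binary.PropositionalEquality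
  using (_≡_; _≢_; refl; sym; trans; cong; cong₂; subst; subst₂; module ≡-Reasoning)
open import Relation.Nullary using (¬_; Dec; yes; no; contradiction; ¬?; _×-dec_; _⊎-dec_)
open import Relation.Nullary.Decidable using (map′)
open import Relation.Unary using (Pred; Decidable)

private
  variable
    A : Set
    a α β : A
    u w xs ys z S X : List A

-- Substrings and prefixes

infix 4 _≼_

_≼_ : List A → List A → Set
_≼_ = Prefix _≡_

≼-refl : w ≼ w
≼-refl = Prefix.fromPointwise (Pointwise.refl refl)

≼-occurs-trans : u ≼ w → w occursIn S → u occursIn S
≼-occurs-trans = Prefix-Infix-trans trans

occurs-refl : w occursIn w
occurs-refl = here ≼-refl

occurs-trans : u occursIn w → w occursIn S → u occursIn S
occurs-trans = Infix.trans trans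

≼-∷ʳ⁻ : ∀ y → u ≼ y ∷ʳ β → u ≡ y ∷ʳ β ⊎ u ≼ y
≼-∷ʳ⁻ []      []           = inj₂ []
≼-∷ʳ⁻ []      (refl ∷ [])  = inj₁ refl
≼-∷ʳ⁻ (x ∷ y) []           = inj₂ []
≼-∷ʳ⁻ (x ∷ y) (refl ∷ u≼y) with ≼-∷ʳ⁻ y u≼y
... | inj₁ refl = inj₁ refl
... | inj₂ u≼y′ = inj₂ (refl ∷ u≼y′)

≢-∷ʳ : ∀ (y : List A) → y ≢ y ∷ʳ β
≢-∷ʳ (_ ∷ y) eq = ≢-∷ʳ y (∷-injectiveʳ eq)

≢-∷ : ∀ (y : List A) → y ≢ α ∷ y
≢-∷ (_ ∷ y) eq with refl ← ∷-injectiveˡ eq = ≢-∷ y (∷-injectiveʳ eq)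

-- Wherever the occurrence starts, everything after its first letter lies beyond the leading `a`.
occurs-tail : α ∷ u occursIn a ∷ X → u occursIn X
occurs-tail             (here (_ ∷ u≼X)) = here u≼X
occurs-tail {X = _ ∷ _} (there i)        = there (occurs-tail i)
occurs-tail {X = []}    (there (here ()))

occurs⇒head∈ : α ∷ u occursIn S → α ∈ S
occurs⇒head∈ (here (refl ∷ _)) = here refl
occurs⇒head∈ (there i)         = there (occurs⇒head∈ i)

occurs⇒≼tail : w occursIn S → ∃[ t ] t ∈ tails S × w ≼ t
occurs⇒≼tail {S = []}    (here w≼S) = _ , here refl , w≼S
occurs⇒≼tail {S = _ ∷ _} (here w≼S) = _ , here refl , w≼S
occurs⇒≼tail {S = _ ∷ _} (there i) with t , t∈ , w≼t ← occurs⇒≼tail i = t , there t∈ , w≼t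

length-tails : ∀ (xs : List A) → length (tails xs) ≡ suc (length xs)
length-tails []       = refl
length-tails (_ ∷ xs) = cong suc (length-tails xs)

reverse-occurs : u occursIn S → reverse u occursIn reverse S
reverse-occurs             (here u≼S) = fromSuffix (fromPrefix u≼S)
reverse-occurs {S = b ∷ S} (there i)  =
  subst (_ occursIn_) (sym (unfold-reverse b S)) (reverse-occurs i ⁱ++ [ b ])

reverse-occurs⁻ : reverse u occursIn reverse S → u occursIn S
reverse-occurs⁻ i = subst₂ _occursIn_ (reverse-involutive _) (reverse-involutive _) (reverse-occurs i)

-- Minimal absent words are tested on the two longest proper substrings only

module _ {α β : A} {y : List A} (eq : α ∷ z ≡ y ∷ʳ β) where

  -- `eq` splits one word at both ends. A proper substring lies in `z`, or else is a prefix that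
  -- misses the last letter and so lies in `y`.
  maw⁺ : ¬ (α ∷ z occursIn S) → z occursIn S → y occursIn S → MAW S (α ∷ z)
  maw⁺ {S = S} absent z-occ y-occ = (λ ()) , absent , proper
    where
    proper : ∀ u → ProperSubstring u (α ∷ z) → u occursIn S
    proper u (there i , _)    = occurs-trans i z-occ
    proper u (here u≼w , u≢w) with ≼-∷ʳ⁻ y (subst (u ≼_) eq u≼w)
    ... | inj₁ u≡w = contradiction (trans u≡w (sym eq)) u≢w
    ... | inj₂ u≼y = ≼-occurs-trans u≼y y-occ

  maw-tail : MAW S (α ∷ z) → z occursIn S
  maw-tail (_ , _ , proper) = proper _ (there occurs-refl , ≢-∷ _)

  maw-init : MAW S (α ∷ z) → y occursIn S
  maw-init (_ , _ , proper) = proper _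
    (subst (y occursIn_) (sym eq) (here (≼-refl ++ᵖ [ β ])) , λ y≡w → ≢-∷ʳ y (trans y≡w eq))

unsnoc-∷ : ∀ (α : A) z → ∃₂ λ y β → α ∷ z ≡ y ∷ʳ β
unsnoc-∷ α z with initLast z
... | []     = [] , α , refl
... | u ∷ʳ′ β = α ∷ u , β , refl

-- Minimal absent words under reversal

maw-reverse : MAW S w → MAW (reverse S) (reverse w)
maw-reverse {S = S} {w = w} (w≢[] , absent , proper) =
  w≢[] ∘ reverse-injective , absent ∘ reverse-occurs⁻ , proper′
  where
  proper′ : ∀ u → ProperSubstring u (reverse w) → u occursIn reverse S
  proper′ u (i , u≢w) = subst (_occursIn reverse S) (reverse-involutive u)
    (reverse-occurs (proper (reverse u)
      ( reverse-occurs⁻ (subst (_occursIn reverse w) (sym (reverse-involutive u)) i)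
      , λ eq → u≢w (trans (sym (reverse-involutive u)) (cong reverse eq)))))

maw-reverse⁻ : MAW (reverse S) (reverse w) → MAW S w
maw-reverse⁻ m = subst₂ MAW (reverse-involutive _) (reverse-involutive _) (maw-reverse m)

△-reverse : (MAW S △ MAW X) w → (MAW (reverse S) △ MAW (reverse X)) (reverse w)
△-reverse (inj₁ (m , ¬m)) = inj₁ (maw-reverse m , ¬m ∘ maw-reverse⁻)
△-reverse (inj₂ (m , ¬m)) = inj₂ (maw-reverse m , ¬m ∘ maw-reverse⁻)

-- Junk value: the whole list if no prefix violates Q.
firstViolation : {Q : Pred (List A) 0ℓ} → Decidable Q → List A → List A
firstViolation Q? []       = []
firstViolation Q? (x ∷ xs) with Q? []
... | no  _ = []
... | yes _ = x ∷ firstViolation (Q? ∘ (x ∷_)) xs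

firstViolation-[] : {Q : Pred (List A) 0ℓ} (Q? : Decidable Q) → ¬ Q [] →
                    ∀ xs → firstViolation Q? xs ≡ []
firstViolation-[] Q? ¬q []      = refl
firstViolation-[] Q? ¬q (_ ∷ _) with Q? []
... | no  _ = refl
... | yes q = contradiction q ¬q

-- The search cannot stop within `y` and must stop right after `β`. Hence, for fixed `Q`, the word
-- is determined by `xs`, which is how words are counted below.
firstViolation-unique :
  {Q : Pred (List A) 0ℓ} (Q? : Decidable Q) → ∀ y →
  (∀ {p} → p ≼ y → Q p) → ¬ Q (y ∷ʳ β) → y ∷ʳ β ≼ xs → firstViolation Q? xs ≡ y ∷ʳ β
firstViolation-unique Q? [] q ¬q (_∷_ {bs = bs} refl _) with Q? []
... | no ¬q[] = contradiction (q []) ¬q[]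
... | yes _   = cong (_ ∷_) (firstViolation-[] _ ¬q bs)
firstViolation-unique Q? (x ∷ y) q ¬q (refl ∷ y≼xs) with Q? []
... | no ¬q[] = contradiction (q []) ¬q[]
... | yes _   = cong (x ∷_) (firstViolation-unique _ y (q ∘ (refl ∷_)) ¬q y≼xs)

-- Decidability of minimal absence

module _ (_≟_ : DecidableEquality A) where

  occurs? : ∀ (w S : List A) → Dec (w occursIn S)
  occurs? = infix? _≟_

  maw? : ∀ (S : List A) → Decidable (MAW S)
  maw? S []      = no λ (w≢[] , _) → w≢[] refl
  maw? S (α ∷ z) with y , β , eq ← unsnoc-∷ α z =
    map′ (λ (absent , z-occ , y-occ) → maw⁺ eq absent z-occ y-occ)
         (λ m → proj₁ (proj₂ m) , maw-tail eq m , maw-init eq m)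
         (¬? (occurs? (α ∷ z) S) ×-dec occurs? z S ×-dec occurs? y S)

  △? : ∀ (S X : List A) → Decidable (MAW S △ MAW X)
  △? S X w = (maw? S w ×-dec ¬? (maw? X w)) ⊎-dec (maw? X w ×-dec ¬? (maw? S w))

  -- The triangle inequality for symmetric differences; constructively, membership in the middle set
  -- has to be decided.
  △-via : ∀ (X : List A) → (MAW S △ MAW z) w → (MAW S △ MAW X) w ⊎ (MAW X △ MAW z) w
  △-via {w = w} X (inj₁ (m , ¬m)) with maw? X w
  ... | yes n = inj₂ (inj₁ (n , ¬m))
  ... | no ¬n = inj₁ (inj₁ (m , ¬n))
  △-via {w = w} X (inj₂ (m , ¬m)) with maw? X w
  ... | yes n = inj₁ (inj₂ (n , ¬m))
  ... | no ¬n = inj₂ (inj₂ (m , ¬n))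

  -- Prepending a letter

  module _ (a : A) (X : List A) where

    -- Even if all of `a ∷ X` is returned, it is absent from `X`, being longer.
    newPrefix : List A
    newPrefix = firstViolation (λ w → occurs? w X) (a ∷ X)

    -- Candidates only: repetitions and words outside the symmetric difference are allowed. They are
    -- indexed by positions and tails of `a ∷ X`, so the length is independent of the alphabet.
    leftCover rightCover prependCover : List (List A)
    leftCover    = map (_∷ newPrefix) (a ∷ X)
    rightCover   = map (λ t → a ∷ firstViolation (λ w → Prefix.prefix? _≟_ w X) t) (tails (a ∷ X))
    prependCover = newPrefix ∷ leftCover ++ rightCover

    newPrefix-unique : ∀ y → y occursIn X → ¬ (y ∷ʳ β occursIn X) → y ∷ʳ β occursIn a ∷ X →
                       newPrefix ≡ y ∷ʳ β
    newPrefix-unique y y-occ absent (there i)  = contradiction i absent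
    newPrefix-unique y y-occ absent (here y≼) =
      firstViolation-unique _ y (λ p≼y → ≼-occurs-trans p≼y y-occ) absent y≼

    lost-∈ : MAW X w → ¬ MAW (a ∷ X) w → w ∈ prependCover
    lost-∈ {w = []}    (w≢[] , _) _ = contradiction refl w≢[]
    lost-∈ {w = α ∷ z} m ¬m with y , β , eq ← unsnoc-∷ α z | occurs? (α ∷ z) (a ∷ X)
    -- Occurrences in `X` persist in `a ∷ X`, so a word that stays absent stays minimal.
    ... | no absent = contradiction (maw⁺ eq absent (there (maw-tail eq m)) (there (maw-init eq m))) ¬m
    ... | yes occ   = here (trans eq (sym (newPrefix-unique y (maw-init eq m)
                        (subst (λ w → ¬ (w occursIn X)) eq (proj₁ (proj₂ m)))
                        (subst (_occursIn a ∷ X) eq occ))))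

    gained-∈ : MAW (a ∷ X) w → ¬ MAW X w → w ∈ prependCover
    gained-∈ {w = []}    (w≢[] , _) _ = contradiction refl w≢[]
    gained-∈ {w = α ∷ z} m ¬m with initLast z
    -- A single letter absent from `a ∷ X` is absent from `X`, and its only proper substring is
    -- empty.
    ... | [] = contradiction (maw⁺ {y = []} refl (proj₁ (proj₂ m) ∘ there) (here []) (here [])) ¬m
    ... | u ∷ʳ′ β with occurs? (u ∷ʳ β) X | maw-tail {y = α ∷ u} refl m | maw-init {y = α ∷ u} refl m
    -- Here `u` occurs in `X` but `u ∷ʳ β` occurs only in `a ∷ X`, which forces it to be
    -- `newPrefix`.
    ...   | no absent | uβ-occ | αu-occ =
            there (∈-++⁺ˡ (subst (λ v → α ∷ v ∈ leftCover)
              (newPrefix-unique u (occurs-tail αu-occ) absent uβ-occ)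
              (∈-map⁺ (_∷ newPrefix) (occurs⇒head∈ αu-occ))))
    -- Both longest proper substrings occur in `X`, so the word was already minimal there.
    ...   | yes occ | _ | there i =
            contradiction (maw⁺ {y = α ∷ u} refl (proj₁ (proj₂ m) ∘ there) occ i) ¬m
    -- Now `α` is `a` and `u` is a prefix of `X`. If `u ∷ʳ β` were one too, the whole word would
    -- occur at the front of `a ∷ X`.
    ...   | yes _ | uβ-occ | here (refl ∷ u≼X) with t , t∈ , uβ≼t ← occurs⇒≼tail uβ-occ =
            there (∈-++⁺ʳ leftCover (subst (λ v → α ∷ v ∈ rightCover)
              (firstViolation-unique _ u (λ p≼u → Prefix.trans trans p≼u u≼X)
                (λ uβ≼X → proj₁ (proj₂ m) (here (refl ∷ uβ≼X))) uβ≼t)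
              (∈-map⁺ _ t∈)))

    △-prepend-∈ : (MAW (a ∷ X) △ MAW X) w → w ∈ prependCover
    △-prepend-∈ (inj₁ (m , ¬m)) = gained-∈ m ¬m
    △-prepend-∈ (inj₂ (m , ¬m)) = lost-∈ m ¬m

    -- One word for `newPrefix`, one for each of the |X| + 1 letters of `a ∷ X`, and one for each of
    -- its |X| + 2 tails, the empty tail included.
    length-prependCover : length prependCover ≡ 2 * suc (suc (length X))
    length-prependCover = begin
      suc (length (leftCover ++ rightCover))          ≡⟨ cong suc (length-++ leftCover) ⟩
      suc (length leftCover + length rightCover)      ≡⟨ cong₂ (λ m n → suc (m + n))
                                                           (length-map _ (a ∷ X))
                                                           (trans (length-map _ (tails (a ∷ X))) (length-tails (a ∷ X))) ⟩
      suc (suc (length X)) + suc (suc (length X))     ≡⟨ cong (suc (suc (length X)) +_) (ℕ.+-identityʳ _) ⟨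
      2 * suc (suc (length X))                        ∎
      where open ≡-Reasoning

  -- Sliding the window

  module _ (a : A) (X : List A) (b : A) where

    slideCover : List (List A)
    slideCover = prependCover a X ++ map reverse (prependCover b (reverse X))

    △-slide-∈ : (MAW (a ∷ X) △ MAW (X ∷ʳ b)) w → w ∈ slideCover
    △-slide-∈ {w = w} δ with △-via X δ
    ... | inj₁ δ′ = ∈-++⁺ˡ (△-prepend-∈ a X δ′)
    -- Reversal turns `X ∷ʳ b` into `b ∷ reverse X`; `swap` puts the longer word first.
    ... | inj₂ δ′ = ∈-++⁺ʳ (prependCover a X) (subst (_∈ _) (reverse-involutive w)
            (∈-map⁺ reverse (△-prepend-∈ b (reverse X) {w = reverse w} (swap (subst
              (λ S → (MAW (reverse X) △ MAW S) (reverse w)) (reverse-++ X [ b ])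
              (△-reverse {S = X} {X = X ∷ʳ b} δ′))))))

    length-slideCover : length slideCover ≡ 4 * suc (suc (length X))
    length-slideCover = begin
      length slideCover                                         ≡⟨ length-++ (prependCover a X) ⟩
      length (prependCover a X) + length (map reverse (prependCover b (reverse X)))
        ≡⟨ cong₂ _+_ (length-prependCover a X)
             (trans (length-map reverse (prependCover b (reverse X))) (length-prependCover b (reverse X))) ⟩
      2 * k + 2 * suc (suc (length (reverse X)))                ≡⟨ cong (λ n → 2 * k + 2 * suc (suc n)) (length-reverse X) ⟩
      2 * k + 2 * k                                             ≡⟨ ℕ.*-distribʳ-+ k 2 2 ⟨
      4 * k                                                     ∎
      where
      open ≡-Reasoning
      k = suc (suc (length X))

-- Cardinality and duplicate-free lists

-- Filtering the cover by `P` and removing repetitions yields an exact enumeration, and neither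
-- operation lengthens the list.
covered⇒finite : DecidableEquality A → {P : Pred A 0ℓ} → Decidable P →
                 ∀ xs → (∀ {x} → P x → x ∈ xs) → ∃[ k ] HasCardinality P k × k ≤ length xs
covered⇒finite _≟_ P? xs cover =
  _ , (deduplicate _≟_ (filter P? xs) , deduplicate-! _≟_ _ , refl , λ x → mk⇔
         (λ x∈ → proj₂ (∈-filter⁻ P? {xs = xs} (∈-deduplicate⁻ _≟_ (filter P? xs) x∈)))
         (λ px → ∈-deduplicate⁺ _≟_ (∈-filter⁺ P? (cover px) px)))
    , ≤-trans (length-deduplicate _≟_ (filter P? xs)) (length-filter P? xs)

lookup-injective : Unique xs → ∀ {i j} → lookup xs i ≡ lookup xs j → i ≡ j
lookup-injective (x∉ ∷ xs!) {zero}  {zero}  eq = refl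
lookup-injective (x∉ ∷ xs!) {zero}  {suc j} eq = contradiction eq (All.lookup x∉ (∈-lookup j))
lookup-injective (x∉ ∷ xs!) {suc i} {zero}  eq = contradiction (sym eq) (All.lookup x∉ (∈-lookup i))
lookup-injective (x∉ ∷ xs!) {suc i} {suc j} eq = cong suc (lookup-injective xs! eq)

-- Sending each position in `xs` to a position of the same element in `ys` is an injection between
-- finite sets.
Unique⇒length≤ : Unique xs → (∀ {x} → x ∈ xs → x ∈ ys) → length xs ≤ length ys
Unique⇒length≤ {xs = xs} {ys = ys} xs! sub = injective⇒≤ {f = index ∘ sub′} λ {i} {j} eq →
  lookup-injective xs! (trans (lookup-index (sub′ i))
    (trans (cong (lookup ys) eq) (sym (lookup-index (sub′ j)))))
  where
  sub′ : ∀ i → lookup xs i ∈ ys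
  sub′ i = sub (∈-lookup i)

-- Windows of a text

window : ∀ i d (T : List A) → T [ suc i ⋯ suc i + d ∸ 1 ] ≡ take d (drop i T)
window i d T = cong (λ n → take n (drop i T)) (ℕ.m+n∸m≡n i d)

nextWindow : ∀ i d (T : List A) → T [ suc i + 1 ⋯ suc i + d ] ≡ take d (drop (suc i) T)
nextWindow i d T rewrite ℕ.+-comm i 1 = cong (λ n → take n (drop (suc i) T)) (ℕ.m+n∸m≡n i d)

take-suc-∷ʳ : ∀ n (Y : List A) → n < length Y → ∃[ b ] take (suc n) Y ≡ take n Y ∷ʳ b
take-suc-∷ʳ zero    (b ∷ _) _         = b , refl
take-suc-∷ʳ (suc n) (y ∷ Y) (s≤s n<) with b , eq ← take-suc-∷ʳ n Y n< = b , cong (y ∷_) eq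

-- The shapes of the two windows are kept as equations so that they can be rewritten in a goal about
-- the windows.
record Slide (n : ℕ) (S S′ : List A) : Set where
  constructor slide
  field
    {first last} : A
    {common}     : List A
    S≡           : S ≡ first ∷ common
    S′≡          : S′ ≡ common ∷ʳ last
    length≤      : length common ≤ n

slide-windows : ∀ n i (T : List A) → i + suc n < length T →
                Slide n (take (suc n) (drop i T)) (take (suc n) (drop (suc i) T))
slide-windows n zero    (_ ∷ Y) (s≤s n<) =
  slide refl (proj₂ (take-suc-∷ʳ n Y n<)) (≤-trans (≤-reflexive (length-take n Y)) (ℕ.m⊓n≤m n _))
slide-windows n (suc i) (_ ∷ T) (s≤s i<) = slide-windows n i T i<

windows-△-finite : DecidableEquality A → ∀ n i (T : List A) → i + suc n < length T →
  ∃[ k ] (HasCardinality (MAW (T [ suc i ⋯ suc i + suc n ∸ 1 ]) △ MAW (T [ suc i + 1 ⋯ suc i + suc n ])) k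
          × k ≤ 8 * suc n)
windows-△-finite _≟_ n i T i<
  rewrite window i (suc n) T | nextWindow i (suc n) T
  with slide {a} {b} {X} S≡ S′≡ length≤ ← slide-windows n i T i<
  rewrite S≡ | S′≡
  with k , card , k≤ ← covered⇒finite (≡-dec _≟_) (△? _≟_ (a ∷ X) (X ∷ʳ b))
                         (slideCover _≟_ a X b) (△-slide-∈ _≟_ a X b)
  = k , card , (begin
      k                           ≤⟨ k≤ ⟩
      length (slideCover _≟_ a X b) ≡⟨ length-slideCover _≟_ a X b ⟩
      4 * suc (suc (length X))    ≤⟨ ℕ.*-monoʳ-≤ 4 (s≤s (s≤s length≤)) ⟩
      -- n + 2 ≤ 2(n + 1), which turns the factor 4 of the cover into the constant 8.
      4 * suc (suc n)             ≤⟨ ℕ.*-monoʳ-≤ 4 (s≤s (ℕ.m≤m+n (suc n) (n + 0))) ⟩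
      4 * suc (suc n + (n + 0))   ≡⟨ cong (λ m → 4 * suc m) (ℕ.+-suc n (n + 0)) ⟨
      4 * (2 * suc n)             ≡⟨ ℕ.*-assoc 4 2 (suc n) ⟨
      8 * suc n                   ∎)
  where open ℕ.≤-Reasoning

-- The lower bound from distinct letters

∈⇒occurs : α ∈ S → [ α ] occursIn S
∈⇒occurs (here refl) = here (refl ∷ [])
∈⇒occurs (there α∈)  = there (∈⇒occurs α∈)

△-lower-bound : ∀ {S′ k} → Unique (a ∷ X) → a ∉ S′ →
                HasCardinality (MAW (a ∷ X) △ MAW S′) k → suc (length X) ≤ k
△-lower-bound {a = a} {X = X} {S′ = S′} aX! a∉S′ (ws , _ , refl , ∈ws⇔) = begin
  length (a ∷ X)                      ≡⟨ length-map (_∷ [ a ]) (a ∷ X) ⟨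
  length (map (_∷ [ a ]) (a ∷ X))     ≤⟨ Unique⇒length≤ (Unique.map⁺ ∷-injectiveˡ aX!) sub ⟩
  length ws                           ∎
  where
  open ℕ.≤-Reasoning

  sub : w ∈ map (_∷ [ a ]) (a ∷ X) → w ∈ ws
  sub w∈ with x , x∈ , refl ← ∈-map⁻ (_∷ [ a ]) w∈ = Equivalence.from (∈ws⇔ _) (inj₁
    -- An occurrence of `x ∷ [ a ]` in `a ∷ X` would put a second `a` in `X`.
    ( maw⁺ {y = [ x ]} refl (Unique[x∷xs]⇒x∉xs aX! ∘ occurs⇒head∈ ∘ occurs-tail)
        (here (refl ∷ [])) (∈⇒occurs x∈)
    -- Minimality in `S′` would make the tail `[ a ]` occur there.
    , λ m → a∉S′ (occurs⇒head∈ (maw-tail {y = [ x ]} refl m))))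

-- Natural numbers as rationals

-- `fromℕ n` is normalised by a gcd and does not compute for a variable `n`; order and products are
-- therefore transferred from unnormalised fractions.
toℚᵘ-fromℕ : ∀ n → ℚ.toℚᵘ (fromℕ n) ℚᵘ.≃ ℚᵘ.mkℚᵘ (ℤ.+ n) 0
toℚᵘ-fromℕ n = ℚ.toℚᵘ-fromℚᵘ (ℚᵘ.mkℚᵘ (ℤ.+ n) 0)

fromℕ-mono-≤ : ∀ {m n} → m ≤ n → fromℕ m ℚ.≤ fromℕ n
fromℕ-mono-≤ {m} {n} m≤n = ℚ.toℚᵘ-cancel-≤ (begin
  ℚ.toℚᵘ (fromℕ m)    ≃⟨ toℚᵘ-fromℕ m ⟩
  ℚᵘ.mkℚᵘ (ℤ.+ m) 0   ≤⟨ ℚᵘ.*≤* (ℤ.*-monoʳ-≤-nonNeg (ℤ.+ 1) (ℤ.+≤+ m≤n)) ⟩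
  ℚᵘ.mkℚᵘ (ℤ.+ n) 0   ≃⟨ toℚᵘ-fromℕ n ⟨
  ℚ.toℚᵘ (fromℕ n)    ∎)
  where open ℚᵘ.≤-Reasoning

fromℕ-* : ∀ m n → fromℕ (m * n) ≡ fromℕ m ℚ.* fromℕ n
fromℕ-* m n = ℚ.toℚᵘ-injective (begin-equality
  ℚ.toℚᵘ (fromℕ (m * n))                        ≃⟨ toℚᵘ-fromℕ (m * n) ⟩
  ℚᵘ.mkℚᵘ (ℤ.+ (m * n)) 0                       ≡⟨ cong (λ z → ℚᵘ.mkℚᵘ z 0) (ℤ.pos-* m n) ⟩
  ℚᵘ.mkℚᵘ (ℤ.+ m) 0 ℚᵘ.* ℚᵘ.mkℚᵘ (ℤ.+ n) 0      ≃⟨ ℚᵘ.*-cong (toℚᵘ-fromℕ m) (toℚᵘ-fromℕ n) ⟨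
  ℚ.toℚᵘ (fromℕ m) ℚᵘ.* ℚ.toℚᵘ (fromℕ n)        ≃⟨ ℚ.toℚᵘ-homo-* (fromℕ m) (fromℕ n) ⟨
  ℚ.toℚᵘ (fromℕ m ℚ.* fromℕ n)                  ∎)
  where open ℚᵘ.≤-Reasoning

theorem2 : (Σ[ C ∈ ℚ ]
    ((d : ℕ) → 1 ≤ d →
    (σ : ℕ) (T : List (Fin σ)) → d < length T →
    (i : ℕ) → 1 ≤ i → i ≤ length T ∸ d →
    ∃[ k ] (HasCardinality (MAW (T [ i ⋯ i + d ∸ 1 ]) △ MAW (T [ i + 1 ⋯ i + d ])) k
    × fromℕ k ℚ.≤ C ℚ.* fromℕ d)))
    ×
    (Σ[ c ∈ ℚ ] (0ℚ ℚ.< c ×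
    ((d : ℕ) → 1 ≤ d →
    Σ[ σ ∈ ℕ ] Σ[ T′ ∈ List (Fin σ) ] (d + 1 ≤ length T′ ×
    Σ[ j ∈ ℕ ] (1 ≤ j × j ≤ length T′ ∸ d ×
    ∃[ k ] (HasCardinality (MAW (T′ [ j ⋯ j + d ∸ 1 ]) △ MAW (T′ [ j + 1 ⋯ j + d ])) k
    × c ℚ.* fromℕ d ℚ.≤ fromℕ k))))))
theorem2 = (fromℕ 8 , upper) , (ℚ.1ℚ , ℚ.positive⁻¹ ℚ.1ℚ , lower)
  where
  upper : (d : ℕ) → 1 ≤ d →
    (σ : ℕ) (T : List (Fin σ)) → d < length T →
    (i : ℕ) → 1 ≤ i → i ≤ length T ∸ d →
    ∃[ k ] (HasCardinality (MAW (T [ i ⋯ i + d ∸ 1 ]) △ MAW (T [ i + 1 ⋯ i + d ])) k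
    × fromℕ k ℚ.≤ fromℕ 8 ℚ.* fromℕ d)
  upper d@(suc n) _ σ T d< (suc i) _ i≤
    with k , card , k≤ ← windows-△-finite _≟F_ n i T
           -- As `d` is less than the length of `T`, the truncated subtraction is exact.
           (≤-trans (ℕ.+-monoˡ-≤ d i≤) (≤-reflexive (ℕ.m∸n+n≡m (ℕ.<⇒≤ d<))))
    = k , card , subst (fromℕ k ℚ.≤_) (fromℕ-* 8 d) (fromℕ-mono-≤ k≤)

  lower : (d : ℕ) → 1 ≤ d →
    Σ[ σ ∈ ℕ ] Σ[ T′ ∈ List (Fin σ) ] (d + 1 ≤ length T′ ×
    Σ[ j ∈ ℕ ] (1 ≤ j × j ≤ length T′ ∸ d ×
    ∃[ k ] (HasCardinality (MAW (T′ [ j ⋯ j + d ∸ 1 ]) △ MAW (T′ [ j + 1 ⋯ j + d ])) k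
    × ℚ.1ℚ ℚ.* fromℕ d ℚ.≤ fromℕ k)))
  lower d@(suc n) _
    -- This provides the existence of the cardinality `k`; its size is then estimated by
    -- `△-lower-bound`.
    with k , card , _ ← windows-△-finite _≟F_ n 0 (allFin (suc d))
                          (≤-reflexive (sym (length-tabulate {n = suc d} id)))
    = suc d , letters
    , ≤-reflexive (trans (ℕ.+-comm d 1) (sym length-letters))
    , 1 , s≤s z≤n , ≤-reflexive (sym (trans (cong (_∸ d) length-letters) (ℕ.m+n∸n≡m 1 d)))
    , k , card
    , subst (ℚ._≤ fromℕ k) (sym (ℚ.*-identityˡ (fromℕ d))) (fromℕ-mono-≤
        (subst (λ m → suc m ≤ k) length-common (△-lower-bound
          -- Distinctness of the first d letters handles the first window; that of all d + 1 keeps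
          -- its leading letter out of the second.
          (Unique.take⁺ d letters!) (Unique[x∷xs]⇒x∉xs (Unique.take⁺ (suc d) letters!)) card)))
    where
    letters  = allFin (suc d)
    letters! = Unique.allFin⁺ (suc d)

    length-letters : length letters ≡ suc d
    length-letters = length-tabulate {n = suc d} id

    length-common : length (take n (tabulate {n = d} suc)) ≡ n
    length-common = trans (length-take n (tabulate {n = d} suc))
      (trans (cong (n ℕ.⊓_) (length-tabulate {n = d} suc)) (ℕ.m≤n⇒m⊓n≡m (ℕ.n≤1+n n)))
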